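{- Let $\models$ be an intersective mixed consequence truth-relation on a finite set $V$ of truth values, with induced consequence relation $\vdash$ in a constant expressive setting. The following are equivalent: (i) $\vdash$ admits both a G-disjunction and a G-conjunction; (ii) every minimal representation of $\models$ is based on a disjunction-conjunction-compatible list of sets of designated values; (iii) some representation of $\models$ is based on a disjunction-conjunction-compatible list of sets of designated values.
   Context: $V$ contains distinct $1,0$; sets of designated values: $\mathcal{D}\subseteq V$, $1\in\mathcal{D}$, $0\notin\mathcal{D}$. $\gamma\models_{\mathcal{D}_p,\mathcal{D}_c}\delta$ iff ($\gamma\subseteq\mathcal{D}_p\Rightarrow\delta\cap\mathcal{D}_c\neq\emptyset$). An intersective mixed truth-relation is $\models_{\mathcal{D}_p^1,\mathcal{D}_c^1}\cap\dots\cap\models_{\mathcal{D}_p^K,\mathcal{D}_c^K}$; such a list is a representation, based on the list $\mathcal{D}_p^1,\mathcal{D}_c^1,\dots,\mathcal{D}_p^K,\mathcal{D}_c^K$; minimal if $K$ is least possible. A list $\mathcal{D}_1,\dots,\mathcal{D}_n$ is disjunction-conjunction-compatible if (DC1) for each $\mathcal{D}_i$, either some truth value belongs to $\mathcal{D}_i$ and to no other set of the list, or $\mathcal{D}_i$ is included in another, distinct set of the list; and (DC2) for every non-empty sublist $\mathcal{D}'_1,\dots,\mathcal{D}'_{n'}$ there is $x\in V$ such that for every $i$: $x\in\mathcal{D}_i$ iff $\exists i'$ with $\mathcal{D}'_{i'}\subseteq\mathcal{D}_i$. Semantics: valuations mapping atoms to $V$, connectives interpreted by fixed truth functions, extended compositionally,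 every assignment to finitely many distinct atoms realized; constant expressive: every value is the constant value of some formula. $\Gamma\vdash\Delta$ iff $v(\Gamma)\models v(\Delta)$ for all $v$; $\Gamma,A=\Gamma\cup\{A\}$. G-conjunction: $\Gamma,A\wedge B\vdash\Delta$ iff $\Gamma,A,B\vdash\Delta$; $\Gamma\vdash A\wedge B,\Delta$ iff ($\Gamma\vdash A,\Delta$ and $\Gamma\vdash B,\Delta$). G-disjunction: $\Gamma\vdash A\vee B,\Delta$ iff $\Gamma\vdash A,B,\Delta$; $\Gamma,A\vee B\vdash\Delta$ iff ($\Gamma,A\vdash\Delta$ and $\Gamma,B\vdash\Delta$); all for every $\Gamma,\Delta,A,B$. -}

module Defs where

open import Data.Nat using (ℕ; _≤_; NonZero)
open import Data.Fin using (Fin)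
open import Data.Fin.Subset using (Subset; _∈_; _∉_; _⊆_)
open import Data.List using (List; []; _∷_; length; concatMap)
open import Data.List.Relation.Unary.All using (All)
import Data.List.Membership.Propositional as List
import Data.List.Relation.Binary.Sublist.Propositional as Sublist
open import Data.Maybe using (Maybe; just; nothing; maybe′)
open import Data.Product using (_×_; _,_; ∃; ∃-syntax)
open import Data.Sum using (_⊎_)
open import Data.Vec using (Vec; []; _∷_)
open import Function using (_⇔_)
open import Function.Definitions using (Injective)
open import Level using (0ℓ)
open import Relation.Binary using (Rel)
open import Relation.Binary.PropositionalEquality using (_≡_; _≢_)
open import Relation.Unary using (Pred; Satisfiable; _∪_; _∩_; ｛_｝)
  renaming (_⊆_ to _⊆ₚ_)

-- Truth values form the finite set Fin n.  The sets of designated values are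
-- elements of Subset n, hence decidable and extensional (equality of sets is
-- _≡_); the sets of values related by a truth-relation are arbitrary
-- predicates, because they arise as images of arbitrary sets of formulas.

TruthRelation : ℕ → Set₁
TruthRelation n = Rel (Pred (Fin n) 0ℓ) 0ℓ

-- δ ∩ 𝒟c ≠ ∅ is read positively, as inhabitedness.
Mixed : ∀ {n} → Subset n → Subset n → TruthRelation n
Mixed 𝒟p 𝒟c γ δ = γ ⊆ₚ (_∈ 𝒟p) → Satisfiable (δ ∩ (_∈ 𝒟c))

-- The list (𝒟p¹ , 𝒟c¹) , … , (𝒟pᴷ , 𝒟cᴷ), with K its length.
Representation : ℕ → Set
Representation n = List (Subset n × Subset n)

basis : ∀ {n} → Representation n → List (Subset n)
basis = concatMap λ (𝒟p , 𝒟c) → 𝒟p ∷ 𝒟c ∷ []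

module _ {n : ℕ} (𝟏 𝟎 : Fin n) where

  Designating : Subset n → Set
  Designating 𝒟 = 𝟏 ∈ 𝒟 × 𝟎 ∉ 𝒟

  record Represents (ρ : Representation n) (_⊨_ : TruthRelation n) : Set₁ where
    field
      nonEmpty     : NonZero (length ρ)
      designating  : All Designating (basis ρ)
      intersection : ∀ γ δ → γ ⊨ δ ⇔ All (λ (𝒟p , 𝒟c) → Mixed 𝒟p 𝒟c γ δ) ρ

  IntersectiveMixed : TruthRelation n → Set₁
  IntersectiveMixed _⊨_ = ∃[ ρ ] Represents ρ _⊨_

  MinimallyRepresents : Representation n → TruthRelation n → Set₁
  MinimallyRepresents ρ _⊨_ =
    Represents ρ _⊨_ × (∀ ρ′ → Represents ρ′ _⊨_ → length ρ ≤ length ρ′)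

-- "Other" set of the list means a different set, not a different position: the
-- same set may occur several times in a list.
DC1 : ∀ {n} → List (Subset n) → Set
DC1 𝓓 = ∀ 𝒟 → 𝒟 List.∈ 𝓓 →
    (∃[ x ] x ∈ 𝒟 × (∀ 𝒟′ → 𝒟′ List.∈ 𝓓 → 𝒟′ ≢ 𝒟 → x ∉ 𝒟′))
  ⊎ (∃[ 𝒟′ ] 𝒟′ List.∈ 𝓓 × 𝒟′ ≢ 𝒟 × 𝒟 ⊆ 𝒟′)

DC2 : ∀ {n} → List (Subset n) → Set
DC2 𝓓 = ∀ 𝓓′ → 𝓓′ Sublist.⊆ 𝓓 → 𝓓′ ≢ [] →
  ∃[ x ] (∀ 𝒟 → 𝒟 List.∈ 𝓓 → x ∈ 𝒟 ⇔ (∃[ 𝒟′ ] 𝒟′ List.∈ 𝓓′ × 𝒟′ ⊆ 𝒟))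

DisjunctionConjunctionCompatible : ∀ {n} → List (Subset n) → Set
DisjunctionConjunctionCompatible 𝓓 = DC1 𝓓 × DC2 𝓓

record Language : Set₁ where
  field
    Atom       : Set
    Connective : Set
    arity      : Connective → ℕ

data Formula (L : Language) : Set where
  atom     : Language.Atom L → Formula L
  compound : (c : Language.Connective L) →
             Vec (Formula L) (Language.arity L c) → Formula L

record Semantics (n : ℕ) (L : Language) : Set₁ where
  open Language L
  field
    truthFunction : (c : Connective) → Vec (Fin n) (arity c) → Fin n
    -- The admissible valuations, given by their restrictions to atoms.
    Valuation     : Pred (Atom → Fin n) 0ℓ
    realized      : ∀ k (p : Fin k → Atom) → Injective _≡_ _≡_ p →
                    (a : Fin k → Fin n) →
                    ∃[ v ] Valuation v × (∀ i → v (p i) ≡ a i)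

module _ {n : ℕ} {L : Language} (S : Semantics n L) where
  open Language L
  open Semantics S

  mutual
    eval : (Atom → Fin n) → Formula L → Fin n
    eval v (atom p)        = v p
    eval v (compound c As) = truthFunction c (evals v As)

    -- Data.Vec.map (eval v), inlined for the termination checker.
    evals : ∀ {k} → (Atom → Fin n) → Vec (Formula L) k → Vec (Fin n) k
    evals v []       = []
    evals v (A ∷ As) = eval v A ∷ evals v As

  ConstantExpressive : Set
  ConstantExpressive = ∀ x → ∃[ A ] (∀ v → Valuation v → eval v A ≡ x)

  image : (Atom → Fin n) → Pred (Formula L) 0ℓ → Pred (Fin n) 0ℓ
  image v Γ x = ∃[ A ] Γ A × eval v A ≡ x

  Consequence : TruthRelation n → Rel (Pred (Formula L) 0ℓ) 0ℓ
  Consequence _⊨_ Γ Δ = ∀ v → Valuation v → image v Γ ⊨ image v Δ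

module _ {F : Set} (_⊢_ : Rel (Pred F 0ℓ) 0ℓ) where

  IsGConjunction : (F → F → F) → Set₁
  IsGConjunction _∧_ = ∀ Γ Δ A B →
      ((Γ ∪ ｛ A ∧ B ｝) ⊢ Δ ⇔ (Γ ∪ ｛ A ｝ ∪ ｛ B ｝) ⊢ Δ)
    × (Γ ⊢ (｛ A ∧ B ｝ ∪ Δ) ⇔ (Γ ⊢ (｛ A ｝ ∪ Δ) × Γ ⊢ (｛ B ｝ ∪ Δ)))

  IsGDisjunction : (F → F → F) → Set₁
  IsGDisjunction _∨_ = ∀ Γ Δ A B →
      (Γ ⊢ (｛ A ∨ B ｝ ∪ Δ) ⇔ Γ ⊢ (｛ A ｝ ∪ ｛ B ｝ ∪ Δ))
    × ((Γ ∪ ｛ A ∨ B ｝) ⊢ Δ ⇔ ((Γ ∪ ｛ A ｝) ⊢ Δ × (Γ ∪ ｛ B ｝) ⊢ Δ))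

-- A connective is admitted when it can be added: the language is extended with
-- a fresh binary connective (the constructor nothing) interpreted by some truth
-- function, with the same atoms and valuations, and the rules are required for
-- all formulas of the extended language.

_+binary : Language → Language
L +binary = record
  { Atom       = Atom
  ; Connective = Maybe Connective
  ; arity      = maybe′ arity 2
  } where open Language L

new : ∀ {L} → Formula (L +binary) → Formula (L +binary) → Formula (L +binary)
new A B = compound nothing (A ∷ B ∷ [])

extend : ∀ {n L} → Semantics n L → (Fin n → Fin n → Fin n) → Semantics n (L +binary)
extend {n} {L} S f = record
  { truthFunction = truthFunction′
  ; Valuation     = Valuation
  ; realized      = realized
  } where
  open Semantics S
  truthFunction′ : (c : Maybe (Language.Connective L)) →
                   Vec (Fin n) (Language.arity (L +binary) c) → Fin n
  truthFunction′ (just c) xs           = truthFunction c xs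
  truthFunction′ nothing  (x ∷ y ∷ []) = f x y

module _ {n : ℕ} {L : Language} (S : Semantics n L) (_⊨_ : TruthRelation n) where

  AdmitsGConjunction : Set₁
  AdmitsGConjunction = ∃[ f ] IsGConjunction (Consequence (extend S f) _⊨_) new

  AdmitsGDisjunction : Set₁
  AdmitsGDisjunction = ∃[ f ] IsGDisjunction (Consequence (extend S f) _⊨_) new

{-# OPTIONS --safe #-}

-- Order pairs by (P , C) ≼ (P′ , C′) iff P ⊆ P′ and C′ ⊆ C. A representation ρ
-- makes P ⊨ ∁ C fail exactly when (P , C) lies below a member of ρ, so minimal
-- representations are those without comparable members. For a member (P , C) of
-- such a representation, z ∉ P iff P , z ⊨ ∁ C, and z ∈ C iff P ⊨ z , ∁ C; hence
-- the G-rules force the truth functions of ∧ and ∨ to act as meet and join on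
-- membership in every designated set. Meets and joins of truth values then supply
-- the values required by DC1 and DC2. Conversely, DC2 yields truth functions
-- acting as meet and join, and these satisfy the G-rules for any representation.
module Submission where

open import Defs
open import Data.Empty using (⊥-elim)
open import Data.Maybe using (just)
open import Data.Nat using (ℕ; _≤_; NonZero)
import Data.Nat.Properties as ℕ
open import Data.Fin using (Fin; zero; suc)
import Data.Fin.Properties as Fin
open import Data.Fin.Subset using (Subset; _∈_; _∉_; _⊆_)
open import Data.Fin.Subset.Properties using (_∈?_; _⊆?_)
open import Data.Bool.Properties using () renaming (_≟_ to _≟ᵇ_)
open import Data.List using (List; []; _∷_; length; lookup; filter; map; foldr; allFin)
import Data.List.Membership.Propositional as List
open import Data.List.Membership.Propositional using (find; lose)
open import Data.List.Membership.Propositional.Properties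
  using (∈-allFin; ∈-filter⁺; ∈-filter⁻; ∈-lookup)
open import Data.List.Relation.Binary.Pointwise using (Pointwise-≡⇒≡)
import Data.List.Relation.Binary.Sublist.Propositional as Sublist
open import Data.List.Relation.Binary.Sublist.Propositional using (_∷ʳ_; _∷_; [])
open import Data.List.Relation.Binary.Sublist.Propositional.Properties
  using (Any-resp-⊆; filter-⊆; length-mono-≤)
import Data.List.Relation.Binary.Sublist.Heterogeneous.Properties as Sublistₕ
open import Data.List.Relation.Unary.All as All using (All; []; _∷_)
open import Data.List.Relation.Unary.All.Properties using (¬Any⇒All¬)
open import Data.List.Relation.Unary.AllPairs using (AllPairs; []; _∷_)
import Data.List.Relation.Unary.AllPairs.Properties as AllPairs
open import Data.List.Relation.Unary.Any as Any using (Any; here; there; any?; index)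
open import Data.List.Relation.Unary.Any.Properties using (concatMap⁺; concatMap⁻; lookup-index; map⁺; map⁻)
open import Data.Product using (_×_; _,_; ∃-syntax; proj₁; proj₂)
open import Data.Product.Function.NonDependent.Propositional using (_×-⇔_)
open import Data.Sum using (_⊎_; inj₁; inj₂; [_,_])
import Data.Sum as Sum
open import Data.Vec using (Vec; []; _∷_)
open import Data.Vec.Properties using (≡-dec)
open import Function using (_⇔_; mk⇔; id; _∘_; case_of_; Equivalence)
open import Function.Properties.Equivalence using () renaming (sym to ⇔-sym; trans to ⇔-trans)
open import Level using (0ℓ)
open import Relation.Binary.PropositionalEquality
  using (_≡_; _≢_; refl; sym; trans; cong; cong₂; subst; subst₂)
open import Relation.Nullary using (¬_; Dec; yes; no; ¬?; contradiction; _→-dec_; _×-dec_; _⊎-dec_)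
open import Relation.Nullary.Decidable using (decidable-stable)
open import Relation.Unary using (Pred; Satisfiable; _∪_; _∩_; ｛_｝; _≐_)
  renaming (_⊆_ to _⊆ₚ_)
open import Relation.Unary.Properties using (≐-sym)

open Equivalence using (to; from)

-- Decidable propositions and finite subsets

-- Sequents that test a premise describe non-membership, so the left G-rules only give equivalences
-- of negations; decidability of membership removes the negations.
⇔-from-¬ : ∀ {A B : Set} → Dec A → Dec B → (¬ A) ⇔ (¬ B) → A ⇔ B
⇔-from-¬ A? B? e = mk⇔
  (λ a → decidable-stable B? λ ¬b → from e ¬b a)
  (λ b → decidable-stable A? λ ¬a → to e ¬a b)

⊈⇒∃ : ∀ {n} {p q : Subset n} → ¬ p ⊆ q → ∃[ x ] x ∈ p × x ∉ q
⊈⇒∃ {n} {p} {q} p⊈q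
  with x , ¬imp ← Fin.¬∀⟶∃¬ n (λ x → x ∈ p → x ∈ q) (λ x → x ∈? p →-dec x ∈? q)
                              (λ p⊆q → p⊈q λ {x} → p⊆q x)
  = x , decidable-stable (x ∈? p) (λ x∉p → ¬imp λ x∈p → contradiction x∈p x∉p)
      , λ x∈q → ¬imp λ _ → x∈q

-- Representations

Pair : ℕ → Set
Pair n = Subset n × Subset n

module _ {n : ℕ} where

  Holds : Pair n → TruthRelation n
  Holds (P , C) = Mixed P C

  infix 4 _≼_
  _≼_ : Pair n → Pair n → Set
  (P , C) ≼ (P′ , C′) = P ⊆ P′ × C′ ⊆ C

  _≼?_ : ∀ a b → Dec (a ≼ b)
  (P , C) ≼? (P′ , C′) = P ⊆? P′ ×-dec C′ ⊆? C

  ≼-refl : ∀ {a} → a ≼ a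
  ≼-refl = id , id

  ≼-trans : ∀ {a b c} → a ≼ b → b ≼ c → a ≼ c
  ≼-trans (p , c) (p′ , c′) = (λ x → p′ (p x)) , (λ x → c (c′ x))

  -- A larger pair has more premise values and fewer conclusion values, hence a stronger condition.
  -- A member below another thus adds nothing to the intersection.
  Holds-anti-≼ : ∀ {a b γ δ} → a ≼ b → Holds b γ δ → Holds a γ δ
  Holds-anti-≼ (P⊆ , ⊆C) h γ⊆P with x , x∈δ , x∈C ← h (λ x∈γ → P⊆ (γ⊆P x∈γ)) = x , x∈δ , ⊆C x∈C

  -- If `γ` lies within the premise set of `b`, so does `P`; then `(P , C) ⋠ b` leaves a value in
  -- the conclusion set of `b` outside `C`, and `δ` contains it.
  Holds-⋠ : ∀ {P C} b {γ δ} → (_∈ P) ⊆ₚ γ → (_∉ C) ⊆ₚ δ → ¬ (P , C) ≼ b → Holds b γ δ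
  Holds-⋠ b P⊆γ ∁C⊆δ ⋠b γ⊆ with x , x∈ , x∉C ← ⊈⇒∃ (λ ⊆C → ⋠b ((λ x∈P → γ⊆ (P⊆γ x∈P)) , ⊆C))
    = x , ∁C⊆δ x∉C , x∈

  Covers : Representation n → Representation n → Set
  Covers ρ′ ρ = All (λ a → Any (a ≼_) ρ′) ρ

  Incomparable : Pair n → Pair n → Set
  Incomparable a b = ¬ a ≼ b × ¬ b ≼ a

  -- A new pair is dropped if a kept pair lies above it; otherwise it displaces the kept pairs below
  -- it and takes over what they covered.
  maximalElements : ∀ ρ → ∃[ ρ′ ] ρ′ Sublist.⊆ ρ × AllPairs Incomparable ρ′ × Covers ρ′ ρ
  maximalElements []      = [] , [] , [] , []
  maximalElements (a ∷ ρ) with ρ′ , sub , inc , cov ← maximalElements ρ | any? (a ≼?_) ρ′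
  ... | yes a≼ρ′ = ρ′ , a ∷ʳ sub , inc , a≼ρ′ ∷ cov
  ... | no  a⋠ρ′ =
      a ∷ filter ⋠a? ρ′
    , refl ∷ Sublist.⊆-trans (filter-⊆ ⋠a? ρ′) sub
    , All.tabulate (λ b∈ → let b∈ρ′ , b⋠a = ∈-filter⁻ ⋠a? b∈ in (λ a≼b → a⋠ρ′ (lose b∈ρ′ a≼b)) , b⋠a)
      ∷ AllPairs.filter⁺ ⋠a? inc
    , here ≼-refl ∷ All.map recover cov
    where
    ⋠a? : ∀ b → Dec (¬ b ≼ a)
    ⋠a? b = ¬? (b ≼? a)

    recover : ∀ {c} → Any (c ≼_) ρ′ → Any (c ≼_) (a ∷ filter ⋠a? ρ′)
    recover c≼ρ′ with b , b∈ρ′ , c≼b ← find c≼ρ′ | b ≼? a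
    ... | yes b≼a = here (≼-trans c≼b b≼a)
    ... | no  b⋠a = there (lose (∈-filter⁺ ⋠a? b∈ρ′ b⋠a) c≼b)

  -- Incomparability concerns positions, so it also excludes repeated members; counting needs this
  -- sharper form.
  ≼⇒same-index : ∀ {ρ} → AllPairs Incomparable ρ → ∀ i j → lookup ρ i ≼ lookup ρ j → i ≡ j
  ≼⇒same-index (_ ∷ _)   zero    zero    _   = refl
  ≼⇒same-index (inc ∷ _) zero    (suc j) a≼b = contradiction a≼b (proj₁ (All.lookup inc (∈-lookup j)))
  ≼⇒same-index (inc ∷ _) (suc i) zero    a≼b = contradiction a≼b (proj₂ (All.lookup inc (∈-lookup i)))
  ≼⇒same-index (_ ∷ inc) (suc i) (suc j) a≼b = cong suc (≼⇒same-index inc i j a≼b)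

  ≼⇒≡ : ∀ {ρ} → AllPairs Incomparable ρ → ∀ {a b} → a List.∈ ρ → b List.∈ ρ → a ≼ b → a ≡ b
  ≼⇒≡ {ρ} inc a∈ρ b∈ρ a≼b =
    trans a≡ (trans (cong (lookup ρ) (≼⇒same-index inc _ _ (subst₂ _≼_ a≡ b≡ a≼b))) (sym b≡))
    where
    a≡ = lookup-index a∈ρ
    b≡ = lookup-index b∈ρ

  -- Sending each member of ρ to a member of ρ′ above it is injective.
  incomparable-length : ∀ {ρ ρ′} → AllPairs Incomparable ρ → Covers ρ′ ρ → Covers ρ ρ′ →
                        length ρ ≤ length ρ′
  incomparable-length {ρ} {ρ′} inc ρ≼ρ′ ρ′≼ρ = Fin.injective⇒≤ up-injective
    where
    above : ∀ i → Any (lookup ρ i ≼_) ρ′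
    above i = All.lookup ρ≼ρ′ (∈-lookup i)

    up : Fin (length ρ) → Fin (length ρ′)
    up i = index (above i)

    back : ∀ k → Any (lookup ρ′ k ≼_) ρ
    back k = All.lookup ρ′≼ρ (∈-lookup k)

    -- Going up into `ρ′` and back up into `ρ` ends above the starting member, hence at its own
    -- position.
    round : ∀ i → i ≡ index (back (up i))
    round i = ≼⇒same-index inc i _
      (≼-trans (lookup-index (above i)) (lookup-index (back (up i))))

    up-injective : ∀ {i j} → up i ≡ up j → i ≡ j
    up-injective {i} {j} eq = trans (round i) (trans (cong (index ∘ back) eq) (sym (round j)))

  basis⁺ₚ : ∀ {ρ : Representation n} {a} → a List.∈ ρ → proj₁ a List.∈ basis ρ
  basis⁺ₚ a∈ρ = concatMap⁺ _ (Any.map (λ { refl → here refl }) a∈ρ)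

  basis⁺c : ∀ {ρ : Representation n} {a} → a List.∈ ρ → proj₂ a List.∈ basis ρ
  basis⁺c a∈ρ = concatMap⁺ _ (Any.map (λ { refl → there (here refl) }) a∈ρ)

  basis-elim : ∀ {ρ} {Q : Pred (Subset n) 0ℓ} →
               (∀ {P C} → (P , C) List.∈ ρ → Q P × Q C) → ∀ {𝒟} → 𝒟 List.∈ basis ρ → Q 𝒟
  basis-elim {ρ} q 𝒟∈ with find (concatMap⁻ _ {xs = ρ} 𝒟∈)
  ... | _ , a∈ρ , here refl         = proj₁ (q a∈ρ)
  ... | _ , a∈ρ , there (here refl) = proj₂ (q a∈ρ)

-- Minimal representations and membership tests

module _ {n : ℕ} {𝟏 𝟎 : Fin n} {_⊨_ : TruthRelation n} where
  open Represents

  -- If no member of `ρ′` were above `(P , C)`, all of them would accept `P` against the complement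
  -- of `C`, a sequent that `(P , C)` itself refutes.
  Represents⇒Covers : ∀ {ρ ρ′} → Represents 𝟏 𝟎 ρ _⊨_ → Represents 𝟏 𝟎 ρ′ _⊨_ → Covers ρ′ ρ
  Represents⇒Covers {ρ} {ρ′} r r′ = All.tabulate covered
    where
    covered : ∀ {a} → a List.∈ ρ → Any (a ≼_) ρ′
    covered {a@(P , C)} a∈ρ = decidable-stable (any? (a ≼?_) ρ′) λ a⋠ρ′ →
      let P⊨∁C = from (intersection r′ (_∈ P) (_∉ C))
                   (All.map (λ {b} → Holds-⋠ b id id) (¬Any⇒All¬ ρ′ a⋠ρ′))
          _ , x∉C , x∈C = All.lookup (to (intersection r (_∈ P) (_∉ C)) P⊨∁C) a∈ρ id
      in x∉C x∈C

  Represents-sublist : ∀ {ρ ρ′} → ρ′ Sublist.⊆ ρ → Covers ρ′ ρ →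
                       Represents 𝟏 𝟎 ρ _⊨_ → Represents 𝟏 𝟎 ρ′ _⊨_
  Represents-sublist {ρ} {ρ′} sub cov r = record
    { nonEmpty     = inhabited cov (nonEmpty r)
    ; designating  = All.tabulate λ 𝒟∈ →
        All.lookup (designating r) (concatMap⁺ _ (Any-resp-⊆ sub (concatMap⁻ _ {xs = ρ′} 𝒟∈)))
    ; intersection = λ γ δ → mk⇔
        (λ h → let hs = to (intersection r γ δ) h in
               All.tabulate λ a∈ → All.lookup hs (Any-resp-⊆ sub a∈))
        (λ hs → from (intersection r γ δ) (All.map
          (λ a≼ρ′ → let b , b∈ , a≼b = find a≼ρ′ in Holds-anti-≼ a≼b (All.lookup hs b∈)) cov))
    }
    where
    inhabited : ∀ {σ σ′ : Representation n} → Covers σ′ σ → NonZero (length σ) → NonZero (length σ′)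
    inhabited {_ ∷ _} (here _ ∷ _)  _ = _
    inhabited {_ ∷ _} (there _ ∷ _) _ = _

  -- Any two representations cover each other, so one without comparable members is at most as long
  -- as any other.
  minimalRepresentation : IntersectiveMixed 𝟏 𝟎 _⊨_ → ∃[ ρ ] MinimallyRepresents 𝟏 𝟎 ρ _⊨_
  minimalRepresentation (ρ , r) with ρ′ , sub , inc , cov ← maximalElements ρ =
    let r′ = Represents-sublist sub cov r in
    ρ′ , r′ , λ ρ″ r″ → incomparable-length inc (Represents⇒Covers r′ r″) (Represents⇒Covers r″ r′)

  -- The maximal members form a sublist that still represents the relation. By minimality it is no
  -- shorter, so it is the whole list.
  minimal⇒incomparable : ∀ {ρ} → MinimallyRepresents 𝟏 𝟎 ρ _⊨_ → AllPairs Incomparable ρ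
  minimal⇒incomparable {ρ} (r , least) with ρ′ , sub , inc , cov ← maximalElements ρ =
    subst (AllPairs Incomparable)
      (Pointwise-≡⇒≡ (Sublistₕ.toPointwise
        (ℕ.≤-antisym (length-mono-≤ sub) (least ρ′ (Represents-sublist sub cov r))) sub))
      inc

  -- An arbitrary relation on predicates may distinguish coextensive ones; a representation rules
  -- this out.
  ⊨-resp-≐ : ∀ {ρ} → Represents 𝟏 𝟎 ρ _⊨_ → ∀ {γ γ′ δ δ′} → γ ≐ γ′ → δ ≐ δ′ → γ ⊨ δ → γ′ ⊨ δ′
  ⊨-resp-≐ r {γ} {γ′} {δ} {δ′} (γ⊆ , _) (δ⊆ , _) h = from (intersection r γ′ δ′)
    (All.map (λ {a} → resp {a}) (to (intersection r γ δ) h))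
    where
    resp : ∀ {a} → Holds a γ δ → Holds a γ′ δ′
    resp holds γ′⊆ with x , x∈δ , x∈C ← holds (λ x∈γ → γ′⊆ (γ⊆ x∈γ)) = x , δ⊆ x∈δ , x∈C

  module _ {ρ} (r : Represents 𝟏 𝟎 ρ _⊨_) (inc : AllPairs Incomparable ρ)
           {P C} (a∈ρ : (P , C) List.∈ ρ) (X : Pred (Fin n) 0ℓ) where

    -- By incomparability the only member above `(P , C)` is itself. All others accept the sequent
    -- whatever `X` is, so `(P , C)` alone decides it.
    premise-test : ((_∈ P) ∪ X) ⊨ (_∉ C) ⇔ (¬ X ⊆ₚ (_∈ P))
    premise-test = mk⇔
      (λ h X⊆P → let _ , x∉C , x∈C = All.lookup (to (intersection r _ _) h) a∈ρ
                                     λ { (inj₁ x∈P) → x∈P ; (inj₂ x∈X) → X⊆P x∈X }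
                 in x∉C x∈C)
      (λ X⊈P → from (intersection r _ _) (All.tabulate (holds X⊈P)))
      where
      holds : ¬ X ⊆ₚ (_∈ P) → ∀ {b} → b List.∈ ρ → Holds b ((_∈ P) ∪ X) (_∉ C)
      holds X⊈P {b} b∈ρ with (P , C) ≼? b
      ... | no  a⋠b = Holds-⋠ b inj₁ id a⋠b
      ... | yes a≼b with refl ← ≼⇒≡ inc a∈ρ b∈ρ a≼b = λ ⊆P → ⊥-elim (X⊈P λ x∈X → ⊆P (inj₂ x∈X))

    -- Again `(P , C)` alone decides; as its premises are satisfied, a value of `C` must be found,
    -- and the complement of `C` offers none.
    conclusion-test : (_∈ P) ⊨ (X ∪ (_∉ C)) ⇔ Satisfiable (X ∩ (_∈ C))
    conclusion-test = mk⇔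
      (λ h → case-split (All.lookup (to (intersection r _ _) h) a∈ρ id))
      (λ sat → from (intersection r _ _) (All.tabulate (holds sat)))
      where
      case-split : Satisfiable ((X ∪ (_∉ C)) ∩ (_∈ C)) → Satisfiable (X ∩ (_∈ C))
      case-split (x , inj₁ x∈X , x∈C) = x , x∈X , x∈C
      case-split (x , inj₂ x∉C , x∈C) = contradiction x∈C x∉C

      holds : Satisfiable (X ∩ (_∈ C)) → ∀ {b} → b List.∈ ρ → Holds b (_∈ P) (X ∪ (_∉ C))
      holds (x , x∈X , x∈C) {b} b∈ρ with (P , C) ≼? b
      ... | no  a⋠b = Holds-⋠ b id inj₂ a⋠b
      ... | yes a≼b with refl ← ≼⇒≡ inc a∈ρ b∈ρ a≼b = λ _ → x , inj₁ x∈X , x∈C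

-- Meets and joins of truth values

module _ {n : ℕ} where

  ActsAsMeet ActsAsJoin : (Fin n → Fin n → Fin n) → Subset n → Set
  ActsAsMeet f 𝒟 = ∀ x y → f x y ∈ 𝒟 ⇔ (x ∈ 𝒟 × y ∈ 𝒟)
  ActsAsJoin f 𝒟 = ∀ x y → f x y ∈ 𝒟 ⇔ (x ∈ 𝒟 ⊎ y ∈ 𝒟)

  foldr-meet : ∀ {f 𝟏 𝒟} → ActsAsMeet f 𝒟 → 𝟏 ∈ 𝒟 → ∀ xs → foldr f 𝟏 xs ∈ 𝒟 ⇔ All (_∈ 𝒟) xs
  foldr-meet meet 𝟏∈ []       = mk⇔ (λ _ → []) (λ _ → 𝟏∈)
  foldr-meet meet 𝟏∈ (x ∷ xs) = mk⇔
    (λ h → let x∈ , xs∈ = to (meet _ _) h in x∈ ∷ to (foldr-meet meet 𝟏∈ xs) xs∈)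
    (λ { (x∈ ∷ xs∈) → from (meet _ _) (x∈ , from (foldr-meet meet 𝟏∈ xs) xs∈) })

  foldr-join : ∀ {f 𝟎 𝒟} → ActsAsJoin f 𝒟 → 𝟎 ∉ 𝒟 → ∀ xs → foldr f 𝟎 xs ∈ 𝒟 ⇔ Any (_∈ 𝒟) xs
  foldr-join join 𝟎∉ []       = mk⇔ (λ 𝟎∈ → contradiction 𝟎∈ 𝟎∉) λ ()
  foldr-join join 𝟎∉ (x ∷ xs) = mk⇔
    (λ h → case to (join _ _) h of λ
      { (inj₁ x∈) → here x∈ ; (inj₂ xs∈) → there (to (foldr-join join 𝟎∉ xs) xs∈) })
    (λ { (here x∈)   → from (join _ _) (inj₁ x∈)
       ; (there xs∈) → from (join _ _) (inj₂ (from (foldr-join join 𝟎∉ xs) xs∈)) })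

  module _ {𝟏 𝟎 : Fin n} {𝓓 : List (Subset n)}
           (designating : ∀ {𝒟} → 𝒟 List.∈ 𝓓 → Designating 𝟏 𝟎 𝒟) where

    module _ {_∧_ _∨_ : Fin n → Fin n → Fin n}
             (meet : ∀ {𝒟} → 𝒟 List.∈ 𝓓 → ActsAsMeet _∧_ 𝒟)
             (join : ∀ {𝒟} → 𝒟 List.∈ 𝓓 → ActsAsJoin _∨_ 𝒟) where

      -- A single value standing for a whole set: by `⋀-∈` it lies in exactly those listed sets that
      -- include `𝒟`.
      ⋀ : Subset n → Fin n
      ⋀ 𝒟 = foldr _∧_ 𝟏 (filter (_∈? 𝒟) (allFin n))

      ⋀-∈ : ∀ 𝒟′ {𝒟} → 𝒟 List.∈ 𝓓 → ⋀ 𝒟′ ∈ 𝒟 ⇔ 𝒟′ ⊆ 𝒟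
      ⋀-∈ 𝒟′ 𝒟∈ = ⇔-trans (foldr-meet (meet 𝒟∈) (proj₁ (designating 𝒟∈)) _) (mk⇔
        (λ all {x} x∈𝒟′ → All.lookup {xs = filter (_∈? 𝒟′) (allFin n)} all
                           (∈-filter⁺ (_∈? 𝒟′) (∈-allFin x) x∈𝒟′))
        (λ 𝒟′⊆𝒟 → All.tabulate λ x∈ → 𝒟′⊆𝒟 (proj₂ (∈-filter⁻ (_∈? 𝒟′) {xs = allFin n} x∈))))

      lattice⇒DC1 : DC1 𝓓
      lattice⇒DC1 𝒟 𝒟∈ with any? (λ 𝒟′ → ¬? (≡-dec _≟ᵇ_ 𝒟′ 𝒟) ×-dec 𝒟 ⊆? 𝒟′) 𝓓
      ... | yes above = inj₂ (find above)
      -- Any other listed set containing `⋀ 𝒟` would include `𝒟`.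
      ... | no ¬above = inj₁ (⋀ 𝒟 , from (⋀-∈ 𝒟 𝒟∈) id ,
        λ 𝒟′ 𝒟′∈ 𝒟′≢𝒟 x∈𝒟′ → ¬above (lose 𝒟′∈ (𝒟′≢𝒟 , to (⋀-∈ 𝒟 𝒟′∈) x∈𝒟′)))

      lattice⇒DC2 : DC2 𝓓
      -- The join lies in `𝒟` iff some `⋀ 𝒟′` does, that is, iff some `𝒟′` of the sublist is
      -- included in `𝒟`.
      lattice⇒DC2 𝓓′ _ _ = foldr _∨_ 𝟎 (map ⋀ 𝓓′) , λ 𝒟 𝒟∈ →
        ⇔-trans (foldr-join (join 𝒟∈) (proj₂ (designating 𝒟∈)) _) (mk⇔
          (λ any → below 𝒟∈ (find (map⁻ any)))
          (λ (𝒟′ , 𝒟′∈ , 𝒟′⊆𝒟) → map⁺ (lose 𝒟′∈ (from (⋀-∈ 𝒟′ 𝒟∈) 𝒟′⊆𝒟))))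
        where
        below : ∀ {𝒟} → 𝒟 List.∈ 𝓓 → ∃[ 𝒟′ ] 𝒟′ List.∈ 𝓓′ × ⋀ 𝒟′ ∈ 𝒟 → ∃[ 𝒟′ ] 𝒟′ List.∈ 𝓓′ × 𝒟′ ⊆ 𝒟
        below 𝒟∈ (𝒟′ , 𝒟′∈ , ⋀∈) = 𝒟′ , 𝒟′∈ , to (⋀-∈ 𝒟′ 𝒟∈) ⋀∈

    -- DC2 is silent on the empty sublist, for which 𝟎 is the value sought.
    DC2⇒realizes : DC2 𝓓 → {Q : Pred (Subset n) 0ℓ} → (∀ 𝒟 → Dec (Q 𝒟)) →
                   (∀ {𝒟 𝒟′} → 𝒟 ⊆ 𝒟′ → Q 𝒟 → Q 𝒟′) →
                   ∃[ x ] (∀ {𝒟} → 𝒟 List.∈ 𝓓 → x ∈ 𝒟 ⇔ Q 𝒟)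
    -- Since `Q` is upward closed, the listed sets that satisfy it also generate it among the listed
    -- sets.
    DC2⇒realizes dc2 {Q} Q? mono = realize (filter Q? 𝓓) (filter-⊆ Q? 𝓓) (∈-filter⁻ Q?) (∈-filter⁺ Q?)
      where
      realize : ∀ 𝓓′ → 𝓓′ Sublist.⊆ 𝓓 →
                (∀ {𝒟} → 𝒟 List.∈ 𝓓′ → 𝒟 List.∈ 𝓓 × Q 𝒟) →
                (∀ {𝒟} → 𝒟 List.∈ 𝓓 → Q 𝒟 → 𝒟 List.∈ 𝓓′) →
                ∃[ x ] (∀ {𝒟} → 𝒟 List.∈ 𝓓 → x ∈ 𝒟 ⇔ Q 𝒟)
      realize [] _ _ complete = 𝟎 , λ 𝒟∈ → mk⇔
        (λ 𝟎∈ → contradiction 𝟎∈ (proj₂ (designating 𝒟∈)))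
        (λ q → case-[] (complete 𝒟∈ q))
        where
        case-[] : ∀ {𝒟} {A : Set} → 𝒟 List.∈ [] → A
        case-[] ()
      realize 𝓓′@(_ ∷ _) sub sound complete with x , x∈⇔ ← dc2 𝓓′ sub (λ ()) =
        x , λ {𝒟} 𝒟∈ → mk⇔
          (λ x∈𝒟 → let _ , 𝒟′∈ , 𝒟′⊆𝒟 = to (x∈⇔ 𝒟 𝒟∈) x∈𝒟 in mono 𝒟′⊆𝒟 (proj₂ (sound 𝒟′∈)))
          (λ q → from (x∈⇔ 𝒟 𝒟∈) (𝒟 , complete 𝒟∈ q , id))

    -- Containing both `x` and `y` is upward closed in the set, so some value has exactly this
    -- membership pattern; `DC2⇒join` treats containing `x` or `y` alike.
    DC2⇒meet : DC2 𝓓 → ∃[ f ] (∀ {𝒟} → 𝒟 List.∈ 𝓓 → ActsAsMeet f 𝒟)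
    DC2⇒meet dc2 = (λ x y → proj₁ (value x y)) , λ 𝒟∈ x y → proj₂ (value x y) 𝒟∈
      where
      value : ∀ x y → ∃[ z ] (∀ {𝒟} → 𝒟 List.∈ 𝓓 → z ∈ 𝒟 ⇔ (x ∈ 𝒟 × y ∈ 𝒟))
      value x y = DC2⇒realizes dc2 (λ 𝒟 → x ∈? 𝒟 ×-dec y ∈? 𝒟) λ s (x∈ , y∈) → s x∈ , s y∈

    DC2⇒join : DC2 𝓓 → ∃[ f ] (∀ {𝒟} → 𝒟 List.∈ 𝓓 → ActsAsJoin f 𝒟)
    DC2⇒join dc2 = (λ x y → proj₁ (value x y)) , λ 𝒟∈ x y → proj₂ (value x y) 𝒟∈
      where
      value : ∀ x y → ∃[ z ] (∀ {𝒟} → 𝒟 List.∈ 𝓓 → z ∈ 𝒟 ⇔ (x ∈ 𝒟 ⊎ y ∈ 𝒟))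
      value x y = DC2⇒realizes dc2 (λ 𝒟 → x ∈? 𝒟 ⊎-dec y ∈? 𝒟) λ s → Sum.map s s

-- From meets and joins to the G-rules

module _ {n : ℕ} {𝟏 𝟎 : Fin n} {_⊨_ : TruthRelation n} {ρ} (r : Represents 𝟏 𝟎 ρ _⊨_)
         {L : Language} (S : Semantics n L) where
  open Represents r
  open Semantics S

  -- Quantifying over formulas instead of their values lets the rules be checked by cases on the
  -- formulas of a sequent.
  Sequent : (Language.Atom L → Fin n) → Pair n → Pred (Formula L) 0ℓ → Pred (Formula L) 0ℓ → Set
  Sequent v (P , C) Γ Δ = (∀ {A} → Γ A → eval S v A ∈ P) → ∃[ A ] Δ A × eval S v A ∈ C

  Holds⇔Sequent : ∀ v a Γ Δ → Holds a (image S v Γ) (image S v Δ) ⇔ Sequent v a Γ Δ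
  Holds⇔Sequent v (P , C) Γ Δ = mk⇔ holds⇒ sequent⇒
    where
    holds⇒ : Holds (P , C) (image S v Γ) (image S v Δ) → Sequent v (P , C) Γ Δ
    holds⇒ h Γ⊆P with _ , (A , A∈Δ , refl) , A∈C ← h (λ { (A , A∈Γ , refl) → Γ⊆P A∈Γ })
      = A , A∈Δ , A∈C

    sequent⇒ : Sequent v (P , C) Γ Δ → Holds (P , C) (image S v Γ) (image S v Δ)
    sequent⇒ h γ⊆P with A , A∈Δ , A∈C ← h (λ A∈Γ → γ⊆P (_ , A∈Γ , refl))
      = eval S v A , (A , A∈Δ , refl) , A∈C

  Consequence⇔Sequent : ∀ Γ Δ → Consequence S _⊨_ Γ Δ ⇔
                        (∀ v → Valuation v → ∀ {a} → a List.∈ ρ → Sequent v a Γ Δ)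
  Consequence⇔Sequent Γ Δ = mk⇔
    (λ h v val {a} a∈ρ → to (Holds⇔Sequent v a Γ Δ)
      (All.lookup (to (intersection (image S v Γ) (image S v Δ)) (h v val)) a∈ρ))
    (λ h v val → from (intersection (image S v Γ) (image S v Δ))
      (All.tabulate λ {a} a∈ρ → from (Holds⇔Sequent v a Γ Δ) (h v val a∈ρ)))

module _ {n : ℕ} {𝟏 𝟎 : Fin n} {_⊨_ : TruthRelation n} {ρ} (r : Represents 𝟏 𝟎 ρ _⊨_)
         {L : Language} (S : Semantics n L) (f : Fin n → Fin n → Fin n) where

  private
    S′ = extend S f

    seq : ∀ Γ Δ → _
    seq = Consequence⇔Sequent r S′

  -- The rules hold at each valuation and each member separately: the left rule by meets in premise
  -- sets, the right rule by meets in conclusion sets.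
  meet⇒GConjunction : (∀ {𝒟} → 𝒟 List.∈ basis ρ → ActsAsMeet f 𝒟) →
                      IsGConjunction (Consequence S′ _⊨_) new
  meet⇒GConjunction meet Γ Δ A B =
      mk⇔
        (λ h → from (seq _ _) λ v val a∈ρ prem → to (seq _ _) h v val a∈ρ λ
          { (inj₁ D∈Γ)  → prem (inj₁ D∈Γ)
          ; (inj₂ refl) → from (meetₚ a∈ρ v) (prem (inj₂ (inj₁ refl)) , prem (inj₂ (inj₂ refl))) })
        (λ h → from (seq _ _) λ v val a∈ρ prem → to (seq _ _) h v val a∈ρ λ
          { (inj₁ D∈Γ)         → prem (inj₁ D∈Γ)
          ; (inj₂ (inj₁ refl)) → proj₁ (to (meetₚ a∈ρ v) (prem (inj₂ refl)))
          ; (inj₂ (inj₂ refl)) → proj₂ (to (meetₚ a∈ρ v) (prem (inj₂ refl))) })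
    , mk⇔
        (λ h →
            (from (seq _ _) λ v val a∈ρ prem → case to (seq _ _) h v val a∈ρ prem of λ
              { (_ , inj₁ refl , z∈C) → A , inj₁ refl , proj₁ (to (meetc a∈ρ v) z∈C)
              ; (D , inj₂ D∈Δ  , z∈C) → D , inj₂ D∈Δ , z∈C })
          , (from (seq _ _) λ v val a∈ρ prem → case to (seq _ _) h v val a∈ρ prem of λ
              { (_ , inj₁ refl , z∈C) → B , inj₁ refl , proj₂ (to (meetc a∈ρ v) z∈C)
              ; (D , inj₂ D∈Δ  , z∈C) → D , inj₂ D∈Δ , z∈C }))
        (λ (hA , hB) → from (seq _ _) λ v val a∈ρ prem →
          -- A designated formula of `Δ` from either sequent suffices; otherwise both `A` and `B`
          -- are designated.
          case (to (seq _ _) hA v val a∈ρ prem , to (seq _ _) hB v val a∈ρ prem) of λ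
            { ((_ , inj₁ refl , x∈C) , (_ , inj₁ refl , y∈C)) →
                new A B , inj₁ refl , from (meetc a∈ρ v) (x∈C , y∈C)
            ; ((D , inj₂ D∈Δ , z∈C) , _) → D , inj₂ D∈Δ , z∈C
            ; (_ , (D , inj₂ D∈Δ , z∈C)) → D , inj₂ D∈Δ , z∈C })
    where
    meetₚ : ∀ {a} → a List.∈ ρ → ∀ v →
            eval S′ v (new A B) ∈ proj₁ a ⇔ (eval S′ v A ∈ proj₁ a × eval S′ v B ∈ proj₁ a)
    meetₚ a∈ρ v = meet (basis⁺ₚ a∈ρ) (eval S′ v A) (eval S′ v B)

    meetc : ∀ {a} → a List.∈ ρ → ∀ v →
            eval S′ v (new A B) ∈ proj₂ a ⇔ (eval S′ v A ∈ proj₂ a × eval S′ v B ∈ proj₂ a)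
    meetc a∈ρ v = meet (basis⁺c a∈ρ) (eval S′ v A) (eval S′ v B)

  join⇒GDisjunction : (∀ {𝒟} → 𝒟 List.∈ basis ρ → ActsAsJoin f 𝒟) →
                      IsGDisjunction (Consequence S′ _⊨_) new
  join⇒GDisjunction join Γ Δ A B =
      mk⇔
        (λ h → from (seq _ _) λ v val a∈ρ prem → case to (seq _ _) h v val a∈ρ prem of λ
          { (_ , inj₁ refl , z∈C) →
              [ (λ x∈C → A , inj₁ refl , x∈C) , (λ y∈C → B , inj₂ (inj₁ refl) , y∈C) ]
              (to (joinc a∈ρ v) z∈C)
          ; (D , inj₂ D∈Δ  , z∈C) → D , inj₂ (inj₂ D∈Δ) , z∈C })
        (λ h → from (seq _ _) λ v val a∈ρ prem → case to (seq _ _) h v val a∈ρ prem of λ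
          { (_ , inj₁ refl , x∈C)        → new A B , inj₁ refl , from (joinc a∈ρ v) (inj₁ x∈C)
          ; (_ , inj₂ (inj₁ refl) , y∈C) → new A B , inj₁ refl , from (joinc a∈ρ v) (inj₂ y∈C)
          ; (D , inj₂ (inj₂ D∈Δ) , z∈C)  → D , inj₂ D∈Δ , z∈C })
    , mk⇔
        (λ h →
            (from (seq _ _) λ v val a∈ρ prem → to (seq _ _) h v val a∈ρ λ
              { (inj₁ D∈Γ)  → prem (inj₁ D∈Γ)
              ; (inj₂ refl) → from (joinₚ a∈ρ v) (inj₁ (prem (inj₂ refl))) })
          , (from (seq _ _) λ v val a∈ρ prem → to (seq _ _) h v val a∈ρ λ
              { (inj₁ D∈Γ)  → prem (inj₁ D∈Γ)
              ; (inj₂ refl) → from (joinₚ a∈ρ v) (inj₂ (prem (inj₂ refl))) }))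
        (λ (hA , hB) → from (seq _ _) λ v val a∈ρ prem →
          -- The designated disjunct selects the sequent to apply.
          [ (λ x∈P → to (seq _ _) hA v val a∈ρ λ
              { (inj₁ D∈Γ) → prem (inj₁ D∈Γ) ; (inj₂ refl) → x∈P })
          , (λ y∈P → to (seq _ _) hB v val a∈ρ λ
              { (inj₁ D∈Γ) → prem (inj₁ D∈Γ) ; (inj₂ refl) → y∈P }) ]
          (to (joinₚ a∈ρ v) (prem (inj₂ refl))))
    where
    joinₚ : ∀ {a} → a List.∈ ρ → ∀ v →
            eval S′ v (new A B) ∈ proj₁ a ⇔ (eval S′ v A ∈ proj₁ a ⊎ eval S′ v B ∈ proj₁ a)
    joinₚ a∈ρ v = join (basis⁺ₚ a∈ρ) (eval S′ v A) (eval S′ v B)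

    joinc : ∀ {a} → a List.∈ ρ → ∀ v →
            eval S′ v (new A B) ∈ proj₂ a ⇔ (eval S′ v A ∈ proj₂ a ⊎ eval S′ v B ∈ proj₂ a)
    joinc a∈ρ v = join (basis⁺c a∈ρ) (eval S′ v A) (eval S′ v B)

-- From the G-rules to meets and joins

module _ {n : ℕ} {L : Language} (S : Semantics n L) where
  open Semantics S

  -- Sets of formulas whose image does not vary with the valuation; between them consequence reduces
  -- to the truth-relation.
  Denotes : Pred (Formula L) 0ℓ → Pred (Fin n) 0ℓ → Set
  Denotes Γ γ = ∀ v → Valuation v → image S v Γ ≐ γ

  Denotes-singleton : ∀ {A x} → (∀ v → Valuation v → eval S v A ≡ x) → Denotes ｛ A ｝ ｛ x ｝
  Denotes-singleton A≡x v val = (λ { (_ , refl , eq) → trans (sym (A≡x v val)) eq })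
                              , (λ { refl → _ , refl , A≡x v val })

  Denotes-∪ : ∀ {Γ Γ′ γ γ′} → Denotes Γ γ → Denotes Γ′ γ′ → Denotes (Γ ∪ Γ′) (γ ∪ γ′)
  Denotes-∪ d d′ v val =
      (λ { (A , inj₁ A∈ , eq) → inj₁ (proj₁ (d v val) (A , A∈ , eq))
         ; (A , inj₂ A∈ , eq) → inj₂ (proj₁ (d′ v val) (A , A∈ , eq)) })
    , (λ { (inj₁ x∈) → let A , A∈ , eq = proj₂ (d v val) x∈ in A , inj₁ A∈ , eq
         ; (inj₂ x∈) → let A , A∈ , eq = proj₂ (d′ v val) x∈ in A , inj₂ A∈ , eq })

  Denotes-resp-≐ : ∀ {Γ γ γ′} → γ ≐ γ′ → Denotes Γ γ → Denotes Γ γ′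
  Denotes-resp-≐ (γ⊆ , ⊆γ) d v val = (λ x∈ → γ⊆ (proj₁ (d v val) x∈)) , (λ x∈ → proj₂ (d v val) (⊆γ x∈))

  constants : ConstantExpressive S → Pred (Fin n) 0ℓ → Pred (Formula L) 0ℓ
  constants ce γ A = ∃[ x ] γ x × A ≡ proj₁ (ce x)

  Denotes-constants : ∀ ce γ → Denotes (constants ce γ) γ
  Denotes-constants ce γ v val =
      (λ { (_ , (x , x∈γ , refl) , eq) → subst γ (trans (sym (proj₂ (ce x) v val)) eq) x∈γ })
    , (λ {x} x∈γ → proj₁ (ce x) , (x , x∈γ , refl) , proj₂ (ce x) v val)

  Consequence⇔⊨ : ∀ {𝟏 𝟎 : Fin n} {_⊨_ : TruthRelation n} {ρ} → Represents 𝟏 𝟎 ρ _⊨_ →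
                  ∀ {Γ Δ γ δ} → Denotes Γ γ → Denotes Δ δ → Consequence S _⊨_ Γ Δ ⇔ γ ⊨ δ
  Consequence⇔⊨ r dΓ dΔ = mk⇔
    -- The assignment to no atoms yields an admissible valuation.
    (λ h → let v , val , _ = realized 0 (λ ()) (λ { {()} }) (λ ()) in
           ⊨-resp-≐ r (dΓ v val) (dΔ v val) (h v val))
    (λ h v val → ⊨-resp-≐ r (≐-sym (dΓ v val)) (≐-sym (dΔ v val)) h)

-- Truth functions forced by the G-rules

module _ {n : ℕ} {L : Language} (S : Semantics n L) (f : Fin n → Fin n → Fin n) where

  mutual
    embed : Formula L → Formula (L +binary)
    embed (atom p)        = atom p
    embed (compound c As) = compound (just c) (embeds As)

    embeds : ∀ {k} → Vec (Formula L) k → Vec (Formula (L +binary)) k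
    embeds []       = []
    embeds (A ∷ As) = embed A ∷ embeds As

  mutual
    eval-embed : ∀ v A → eval (extend S f) v (embed A) ≡ eval S v A
    eval-embed v (atom p)        = refl
    eval-embed v (compound c As) = cong (Semantics.truthFunction S c) (evals-embeds v As)

    evals-embeds : ∀ {k} v (As : Vec (Formula L) k) → evals (extend S f) v (embeds As) ≡ evals S v As
    evals-embeds v []       = refl
    evals-embeds v (A ∷ As) = cong₂ _∷_ (eval-embed v A) (evals-embeds v As)

  -- The G-rules concern the extended language, so the constants are needed there; embedding
  -- preserves values because old connectives keep their truth functions.
  extend-constantExpressive : ConstantExpressive S → ConstantExpressive (extend S f)
  extend-constantExpressive ce x = let A , A≡x = ce x in
    embed A , λ v val → trans (eval-embed v A) (A≡x v val)

  module _ (ce : ConstantExpressive S) {𝟏 𝟎 : Fin n} {_⊨_ : TruthRelation n} {ρ}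
           (r : Represents 𝟏 𝟎 ρ _⊨_) (inc : AllPairs Incomparable ρ) where

    private
      S′  = extend S f
      ce′ = extend-constantExpressive ce
      _⊢_ = Consequence S′ _⊨_

      ⟦_⟧ : Fin n → Formula (L +binary)
      ⟦ x ⟧ = proj₁ (ce′ x)

      value : ∀ x → Denotes S′ ｛ ⟦ x ⟧ ｝ ｛ x ｝
      value x = Denotes-singleton S′ (proj₂ (ce′ x))

      value-new : ∀ x y → Denotes S′ ｛ new ⟦ x ⟧ ⟦ y ⟧ ｝ ｛ f x y ｝
      value-new x y = Denotes-singleton S′ λ v val →
        cong₂ f (proj₂ (ce′ x) v val) (proj₂ (ce′ y) v val)

    module _ {P C} (a∈ρ : (P , C) List.∈ ρ) where

      private
        Γₚ = constants S′ ce′ (_∈ P)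
        Δc = constants S′ ce′ (_∉ C)

      -- Constants for `P` and for the complement of `C` turn the test on truth values into a
      -- sequent to which the G-rules apply.
      premise-sequent : ∀ {Ξ X} → Denotes S′ Ξ X → (Γₚ ∪ Ξ) ⊢ Δc ⇔ (¬ X ⊆ₚ (_∈ P))
      premise-sequent {X = X} d = ⇔-trans
        (Consequence⇔⊨ S′ r (Denotes-∪ S′ (Denotes-constants S′ ce′ (_∈ P)) d)
                            (Denotes-constants S′ ce′ (_∉ C)))
        (premise-test r inc a∈ρ X)

      conclusion-sequent : ∀ {Θ X} → Denotes S′ Θ (X ∪ (_∉ C)) → Γₚ ⊢ Θ ⇔ Satisfiable (X ∩ (_∈ C))
      conclusion-sequent {X = X} d = ⇔-trans
        (Consequence⇔⊨ S′ r (Denotes-constants S′ ce′ (_∈ P)) d)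
        (conclusion-test r inc a∈ρ X)

      premise₁ : ∀ {A x} → Denotes S′ ｛ A ｝ ｛ x ｝ → (Γₚ ∪ ｛ A ｝) ⊢ Δc ⇔ x ∉ P
      premise₁ d = ⇔-trans (premise-sequent d) (mk⇔
        (λ ⊈P x∈P → ⊈P λ { refl → x∈P })
        (λ x∉P ⊆P → x∉P (⊆P refl)))

      conclusion₁ : ∀ {A x} → Denotes S′ ｛ A ｝ ｛ x ｝ → Γₚ ⊢ (｛ A ｝ ∪ Δc) ⇔ x ∈ C
      conclusion₁ d = ⇔-trans
        (conclusion-sequent (Denotes-∪ S′ d (Denotes-constants S′ ce′ (_∉ C))))
        (mk⇔ (λ { (_ , refl , x∈C) → x∈C }) (λ x∈C → _ , refl , x∈C))

      premise₂ : ∀ x y → (Γₚ ∪ ｛ ⟦ x ⟧ ｝ ∪ ｛ ⟦ y ⟧ ｝) ⊢ Δc ⇔ (¬ (x ∈ P × y ∈ P))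
      premise₂ x y = ⇔-trans (premise-sequent (Denotes-∪ S′ (value x) (value y))) (mk⇔
        (λ ⊈P (x∈P , y∈P) → ⊈P λ { (inj₁ refl) → x∈P ; (inj₂ refl) → y∈P })
        (λ ¬both ⊆P → ¬both (⊆P (inj₁ refl) , ⊆P (inj₂ refl))))

      conclusion₂ : ∀ x y → Γₚ ⊢ (｛ ⟦ x ⟧ ｝ ∪ ｛ ⟦ y ⟧ ｝ ∪ Δc) ⇔ (x ∈ C ⊎ y ∈ C)
      conclusion₂ x y = ⇔-trans
        -- The rule brackets conclusions to the right, while the test keeps both values apart from
        -- the complement of `C`.
        (conclusion-sequent (Denotes-resp-≐ S′ (Sum.assocˡ , Sum.assocʳ)
          (Denotes-∪ S′ (value x) (Denotes-∪ S′ (value y) (Denotes-constants S′ ce′ (_∉ C))))))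
        (mk⇔ (λ { (_ , inj₁ refl , x∈C) → inj₁ x∈C ; (_ , inj₂ refl , y∈C) → inj₂ y∈C })
             (λ { (inj₁ x∈C) → _ , inj₁ refl , x∈C ; (inj₂ y∈C) → _ , inj₂ refl , y∈C }))

    -- For each member, the left rule at constants settles membership in `P` and the right rule
    -- membership in `C`.
    GConjunction⇒meet : IsGConjunction _⊢_ new → ∀ {𝒟} → 𝒟 List.∈ basis ρ → ActsAsMeet f 𝒟
    GConjunction⇒meet g = basis-elim λ {P} {C} a∈ρ →
        (λ x y → ⇔-from-¬ (f x y ∈? P) (x ∈? P ×-dec y ∈? P)
          (⇔-trans (⇔-sym (premise₁ a∈ρ (value-new x y)))
            (⇔-trans (proj₁ (g _ _ _ _)) (premise₂ a∈ρ x y))))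
      , (λ x y → ⇔-trans (⇔-sym (conclusion₁ a∈ρ (value-new x y)))
          (⇔-trans (proj₂ (g _ _ _ _)) (conclusion₁ a∈ρ (value x) ×-⇔ conclusion₁ a∈ρ (value y))))

    GDisjunction⇒join : IsGDisjunction _⊢_ new → ∀ {𝒟} → 𝒟 List.∈ basis ρ → ActsAsJoin f 𝒟
    GDisjunction⇒join g = basis-elim λ {P} {C} a∈ρ →
        (λ x y → ⇔-from-¬ (f x y ∈? P) (x ∈? P ⊎-dec y ∈? P)
          (⇔-trans (⇔-sym (premise₁ a∈ρ (value-new x y)))
            (⇔-trans (proj₂ (g _ _ _ _))
              (⇔-trans (premise₁ a∈ρ (value x) ×-⇔ premise₁ a∈ρ (value y)) ¬×¬⇔¬⊎))))
      , (λ x y → ⇔-trans (⇔-sym (conclusion₁ a∈ρ (value-new x y)))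
          (⇔-trans (proj₁ (g _ _ _ _)) (conclusion₂ a∈ρ x y)))
      where
      ¬×¬⇔¬⊎ : ∀ {A B : Set} → (¬ A × ¬ B) ⇔ (¬ (A ⊎ B))
      ¬×¬⇔¬⊎ = mk⇔ (λ (¬a , ¬b) → [ ¬a , ¬b ]) (λ h → (λ a → h (inj₁ a)) , (λ b → h (inj₂ b)))

-- Equivalence of the three conditions

theorem7p6 : ∀ (n : ℕ) (𝟏 𝟎 : Fin n) → 𝟏 ≢ 𝟎 →
    (_⊨_ : TruthRelation n) → IntersectiveMixed 𝟏 𝟎 _⊨_ →
    (L : Language) (S : Semantics n L) → ConstantExpressive S →
    ((AdmitsGDisjunction S _⊨_ × AdmitsGConjunction S _⊨_) ⇔
    (∀ ρ → MinimallyRepresents 𝟏 𝟎 ρ _⊨_ → DisjunctionConjunctionCompatible (basis ρ)))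
    × ((∀ ρ → MinimallyRepresents 𝟏 𝟎 ρ _⊨_ → DisjunctionConjunctionCompatible (basis ρ)) ⇔
    (∃[ ρ ] (Represents 𝟏 𝟎 ρ _⊨_ × DisjunctionConjunctionCompatible (basis ρ))))
theorem7p6 n 𝟏 𝟎 𝟏≢𝟎 _⊨_ mixed L S ce =
    mk⇔ i⇒ii (λ ii → iii⇒i (ii⇒iii ii)) , mk⇔ ii⇒iii (λ iii → i⇒ii (iii⇒i iii))
  where
  I II III : Set₁
  I   = AdmitsGDisjunction S _⊨_ × AdmitsGConjunction S _⊨_
  II  = ∀ ρ → MinimallyRepresents 𝟏 𝟎 ρ _⊨_ → DisjunctionConjunctionCompatible (basis ρ)
  III = ∃[ ρ ] (Represents 𝟏 𝟎 ρ _⊨_ × DisjunctionConjunctionCompatible (basis ρ))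

  i⇒ii : I → II
  i⇒ii ((_ , g∨) , (_ , g∧)) ρ min@(r , _) =
    lattice⇒DC1 designating meet join , lattice⇒DC2 designating meet join
    where
    -- Minimality enters as incomparability, which isolates each member in the tests.
    inc : AllPairs Incomparable ρ
    inc = minimal⇒incomparable min

    designating : ∀ {𝒟} → 𝒟 List.∈ basis ρ → Designating 𝟏 𝟎 𝒟
    designating = All.lookup (Represents.designating r)

    meet : ∀ {𝒟} → 𝒟 List.∈ basis ρ → ActsAsMeet _ 𝒟
    meet = GConjunction⇒meet S _ ce r inc g∧

    join : ∀ {𝒟} → 𝒟 List.∈ basis ρ → ActsAsJoin _ 𝒟
    join = GDisjunction⇒join S _ ce r inc g∨

  -- A minimal representation exists, so `II` is not vacuous.
  ii⇒iii : II → III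
  ii⇒iii ii = let ρ , min = minimalRepresentation mixed in ρ , proj₁ min , ii ρ min

  iii⇒i : III → I
  iii⇒i (ρ , r , _ , dc2) =
    let designating = All.lookup (Represents.designating r)
        f , join = DC2⇒join designating dc2
        g , meet = DC2⇒meet designating dc2
    in (f , join⇒GDisjunction r S f join) , (g , meet⇒GConjunction r S g meet)
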